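{- Let $n, q \ge 1$ and $s \geq 2$ be integers. The total number $C_T(n, q, s)$ of $s$-collisions in all arrangements of $q$ numbered balls in $n$ numbered tubes is equal to $$ q!\sum_{\lambda} \binom{n}{\lambda_1} \left( \prod_{i=2}^{k} \binom{\lambda_{i-1}}{\lambda_i} \right) \left( \lambda_{k}\binom{k}{s} + \sum_{i=s}^{k-1} ( \lambda_{i} - \lambda_{i+1} )\binom{i}{s} \right), $$ where the sum is over all partitions $\lambda = (\lambda_1,\dots,\lambda_k)$ of $q$ such that $\lambda_1 \leq n$ and whose number of parts $k = |\lambda|$ satisfies $k \geq s$.
   Context: A partition $\lambda$ of a positive integer $q$ is a sequence of integers $\lambda_1 \ge \lambda_2 \ge \dots \ge \lambda_k \ge 1$ with $\sum_{i=1}^k \lambda_i = q$; $k = |\lambda|$ is the number of parts (it depends on $\lambda$). An arrangement of $q$ numbered (distinguishable) balls in $n$ numbered tubes places every ball in exactly one tube, and the order of the balls within each tube (as a column) matters. That is, an arrangement is an assignment to each tube $j \in \{1,\dots,n\}$ of a finite (possibly empty) ordered list of balls such that each of the $q$ balls occurs exactly once in total. Let $s \ge 2$. A tube containing $r$ balls contributes $\binom{r}{s}$ to the number of $s$-collisions of an arrangement (so it contributes $0$ if $r < s$). The number of $s$-collisions of an arrangement is the sum of these contributions over all $n$ tubes, and $C_T(n,q,s)$ is the sum of the numbers of $s$-collisions over all arrangements of $q$ balls in $n$ tubes. Empty products equal $1$ and empty sums equal $0$. -}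

module Defs where

open import Data.Empty using (⊥-elim)
open import Data.Fin as Fin using (Fin; zero; suc)
open import Data.Fin.Properties as Fin using (all?; injective⇒≤)
open import Data.List using (List; []; _∷_; map; length; filter; concat; lookup; applyUpTo; upTo; allFin; cartesianProductWith)
open import Data.List.Membership.Propositional using (_∈_)
open import Data.List.Membership.Propositional.Properties using (∈-cartesianProductWith⁺; ∈-cartesianProductWith⁻; ∈-filter⁺; ∈-filter⁻; ∈-upTo⁺; ∈-allFin; ∈-lookup)
open import Data.List.Properties using (∷-injective; filter-some; filter-accept; filter-++; length-++)
open import Data.List.Relation.Unary.All as All using (All; []; _∷_)
open import Data.List.Relation.Unary.AllPairs using ([]; _∷_)
open import Data.List.Relation.Unary.Any as Any using (here; there)
open import Data.List.Relation.Unary.Linked using (Linked; linked?)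
open import Data.List.Relation.Unary.Unique.Propositional using (Unique)
import Data.List.Relation.Unary.Unique.Propositional.Properties as Unique
open import Data.Nat using (ℕ; zero; suc; _+_; _*_; _∸_; _≤_; _<_; _≥_; z≤n; s≤s; _≤?_; _≥?_; _≟_)
open import Data.Nat.Combinatorics using (_C_)
open import Data.Nat.ListAction using (sum; product)
open import Data.Nat.Properties using (≤-trans; ≤-reflexive; m≤m+n; m≤n+m; +-mono-≤)
open import Data.Product using (_×_; _,_; proj₁; proj₂)
open import Data.Vec as Vec using (Vec; []; _∷_)
import Data.Vec.Properties as Vec
open import Function using (_∘_; Injective; _⇔_; mk⇔)
open import Relation.Binary.PropositionalEquality using (_≡_; refl; sym; trans; cong; subst)
open import Relation.Nullary using (¬_; Dec)
open import Relation.Nullary.Decidable using (_×-dec_)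

private
  variable
    A : Set

infix 6 _⋯_
infixl 6.5 ∑-syntax ∏-syntax

-- The integers i with a ≤ i ≤ b, in increasing order; empty if b < a.
_⋯_ : ℕ → ℕ → List ℕ
a ⋯ b = applyUpTo (a +_) (suc b ∸ a)

∑-syntax : List A → (A → ℕ) → ℕ
∑-syntax xs f = sum (map f xs)

∏-syntax : List A → (A → ℕ) → ℕ
∏-syntax xs f = product (map f xs)

syntax ∑-syntax xs (λ x → e) = ∑[ x ∈ xs ] e
syntax ∏-syntax xs (λ x → e) = ∏[ x ∈ xs ] e

-- All lists of length at most m with entries in xs.
lists≤ : List A → ℕ → List (List A)
lists≤ xs zero    = [] ∷ []
lists≤ xs (suc m) = [] ∷ cartesianProductWith _∷_ xs (lists≤ xs m)

vectors : List A → (n : ℕ) → List (Vec A n)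
vectors xs zero    = [] ∷ []
vectors xs (suc n) = cartesianProductWith _∷_ xs (vectors xs n)

IsPartition : ℕ → List ℕ → Set
IsPartition q μ = Linked _≥_ μ × All (1 ≤_) μ × sum μ ≡ q

isPartition? : ∀ q μ → Dec (IsPartition q μ)
isPartition? q μ = linked? _≥?_ μ ×-dec All.all? (1 ≤?_) μ ×-dec (sum μ ≟ q)

-- A partition of q has at most q parts, each at most q, so this filters a
-- list that contains every partition; see ∈-partitions and partitions-unique.
partitions : ℕ → List (List ℕ)
partitions q = filter (isPartition? q) (lists≤ (upTo (suc q)) q)

-- Parts are indexed from 1: part μ i is μᵢ for 1 ≤ i ≤ length μ.
-- The value 0 outside this range is a dummy.
part : List ℕ → ℕ → ℕ
part []      _             = 0
part (x ∷ μ) zero          = 0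
part (x ∷ μ) (suc zero)    = x
part (x ∷ μ) (suc (suc i)) = part μ (suc i)

-- The balls are Fin q; the j-th component is the ordered content of tube j.
Placement : ℕ → ℕ → Set
Placement n q = Vec (List (Fin q)) n

occurrences : ∀ {n q} → Fin q → Placement n q → ℕ
occurrences b t = length (filter (b Fin.≟_) (concat (Vec.toList t)))

IsArrangement : ∀ {n q} → Placement n q → Set
IsArrangement t = ∀ b → occurrences b t ≡ 1

isArrangement? : ∀ {n q} (t : Placement n q) → Dec (IsArrangement t)
isArrangement? t = all? (λ b → occurrences b t ≟ 1)

-- In an arrangement no tube holds more than q balls, so this filters a list
-- that contains every arrangement; see ∈-arrangements and arrangements-unique.
arrangements : (n q : ℕ) → List (Placement n q)
arrangements n q = filter isArrangement? (vectors (lists≤ (allFin q) q) n)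

collisions : ∀ {n q} → ℕ → Placement n q → ℕ
collisions s t = Vec.sum (Vec.map (λ tube → length tube C s) t)

C-T : ℕ → ℕ → ℕ → ℕ
C-T n q s = ∑[ t ∈ arrangements n q ] collisions s t

------------------------------------------------------------------------
-- The two enumerations are complete and free of repetitions

lists≤-unique : ∀ {xs : List A} → Unique xs → ∀ m → Unique (lists≤ xs m)
lists≤-unique         u zero    = [] ∷ []
lists≤-unique {xs = xs} u (suc m) =
  All.tabulate (λ y∈ []≡y → nonempty y∈ (sym []≡y))
  ∷ Unique.cartesianProductWith⁺ _∷_ ∷-injective u (lists≤-unique u m)
  where
  nonempty : ∀ {y} → y ∈ cartesianProductWith _∷_ xs (lists≤ xs m) → ¬ y ≡ []
  nonempty y∈ refl with ∈-cartesianProductWith⁻ _∷_ xs (lists≤ xs m) y∈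
  ... | _ , _ , _ , _ , ()

vectors-unique : ∀ {xs : List A} → Unique xs → ∀ n → Unique (vectors xs n)
vectors-unique u zero    = [] ∷ []
vectors-unique u (suc n) =
  Unique.cartesianProductWith⁺ _∷_ Vec.∷-injective u (vectors-unique u n)

∈-lists≤ : ∀ {xs ys : List A} {m} → All (_∈ xs) ys → length ys ≤ m → ys ∈ lists≤ xs m
∈-lists≤ {m = zero}  []         _         = here refl
∈-lists≤ {m = suc m} []         _         = here refl
∈-lists≤ {m = suc m} (y∈ ∷ ys∈) (s≤s len) =
  there (∈-cartesianProductWith⁺ _∷_ y∈ (∈-lists≤ ys∈ len))

∈-vectors : ∀ {xs : List A} {n} (v : Vec A n) → (∀ i → Vec.lookup v i ∈ xs) → v ∈ vectors xs n
∈-vectors []      _  = here refl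
∈-vectors (y ∷ v) v∈ = ∈-cartesianProductWith⁺ _∷_ (v∈ zero) (∈-vectors v (v∈ ∘ suc))

partitions-unique : ∀ q → Unique (partitions q)
partitions-unique q =
  Unique.filter⁺ (isPartition? q) (lists≤-unique (Unique.upTo⁺ (suc q)) q)

∈-partitions : ∀ q {μ} → μ ∈ partitions q ⇔ IsPartition q μ
∈-partitions q {μ} = mk⇔ (proj₂ ∘ ∈-filter⁻ (isPartition? q) {xs = lists≤ (upTo (suc q)) q}) to
  where
  parts≤sum : ∀ ν → All (_≤ sum ν) ν
  parts≤sum []      = []
  parts≤sum (x ∷ ν) = m≤m+n x (sum ν) ∷ All.map (λ y≤ → ≤-trans y≤ (m≤n+m (sum ν) x)) (parts≤sum ν)

  length≤sum : ∀ {ν} → All (1 ≤_) ν → length ν ≤ sum ν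
  length≤sum []         = z≤n
  length≤sum (1≤ ∷ all) = +-mono-≤ 1≤ (length≤sum all)

  to : IsPartition q μ → μ ∈ partitions q
  to p@(_ , positive , refl) = ∈-filter⁺ (isPartition? q)
    (∈-lists≤ (All.map (∈-upTo⁺ ∘ s≤s) (parts≤sum μ)) (length≤sum positive)) p

arrangements-unique : ∀ n q → Unique (arrangements n q)
arrangements-unique n q = Unique.filter⁺ isArrangement?
  (vectors-unique (lists≤-unique (Unique.allFin⁺ q) q) n)

∈-arrangements : ∀ n q {t} → t ∈ arrangements n q ⇔ IsArrangement t
∈-arrangements n q {t} =
  mk⇔ (proj₂ ∘ ∈-filter⁻ isArrangement? {xs = vectors (lists≤ (allFin q) q) n}) to
  where
  count : Fin q → List (Fin q) → ℕ
  count b = length ∘ filter (b Fin.≟_)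

  count-++ : ∀ b xs ys → count b (xs Data.List.++ ys) ≡ count b xs + count b ys
  count-++ b xs ys = trans (cong length (filter-++ (b Fin.≟_) xs ys)) (length-++ (filter (b Fin.≟_) xs))

  count-tube≤ : ∀ {m} b (v : Placement m q) j → count b (Vec.lookup v j) ≤ occurrences b v
  count-tube≤ b (x ∷ v) zero    rewrite count-++ b x (concat (Vec.toList v)) = m≤m+n _ _
  count-tube≤ b (x ∷ v) (suc j) rewrite count-++ b x (concat (Vec.toList v)) =
    ≤-trans (count-tube≤ b v j) (m≤n+m _ _)

  count-tail≤ : ∀ b x xs → count b xs ≤ count b (x ∷ xs)
  count-tail≤ b x xs rewrite count-++ b (x ∷ []) xs = m≤n+m _ _

  unrepeated : ∀ xs → (∀ b → count b xs ≤ 1) → ∀ {x y} → x ∷ y ≡ xs → ¬ x ∈ y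
  unrepeated _ c {x} {y} refl x∈ with subst (_≤ 1) (cong length (filter-accept (x Fin.≟_) {x} {y} refl)) (c x)
  ... | s≤s 0≥ with ≤-trans (filter-some (x Fin.≟_) x∈) 0≥
  ... | ()

  lookup-injective : ∀ xs → (∀ b → count b xs ≤ 1) → Injective _≡_ _≡_ (lookup xs)
  lookup-injective (x ∷ xs) c {zero}  {zero}  _  = refl
  lookup-injective (x ∷ xs) c {zero}  {suc j} eq =
    ⊥-elim (unrepeated _ c refl (subst (_∈ xs) (sym eq) (∈-lookup j)))
  lookup-injective (x ∷ xs) c {suc i} {zero}  eq =
    ⊥-elim (unrepeated _ c refl (subst (_∈ xs) eq (∈-lookup i)))
  lookup-injective (x ∷ xs) c {suc i} {suc j} eq =
    cong suc (lookup-injective xs (λ b → ≤-trans (count-tail≤ b x xs) (c b)) eq)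

  to : IsArrangement t → t ∈ arrangements n q
  to a = ∈-filter⁺ isArrangement? (∈-vectors t (λ j →
    ∈-lists≤ (All.tabulate (λ {b} _ → ∈-allFin b))
             (injective⇒≤ (lookup-injective (Vec.lookup t j)
               (λ b → ≤-trans (count-tube≤ b t j) (≤-reflexive (a b))))))) a

{-# OPTIONS --safe #-}
module Submission where

-- An arrangement is a shape, the vector of tube sizes, together with one of the
-- q ! orders in which the balls are read off tube by tube.  A shape is peeled into
-- layers: λᵢ is the number of tubes with at least i balls.  The tubes of layer i
-- are chosen among those of layer i - 1, so n C λ₁ * ∏ (λᵢ₋₁ C λᵢ) shapes have layers λ,
-- and λᵢ ∸ λᵢ₊₁ of the tubes hold exactly i balls, each contributing i C s.
-- The product vanishes unless λ is decreasing, and the inner sum unless λ has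
-- at least s parts, which turns the sum over all layer sequences into one over partitions.

open import Defs
open import Data.Fin as Fin using (Fin; zero; suc; punchIn; punchOut)
open import Data.Fin.Properties as Fin using (punchIn-injective; punchInᵢ≢i; punchIn-punchOut)
open import Data.List
  using (List; []; _∷_; _++_; map; length; filter; concat; cartesianProduct;
    cartesianProductWith; applyUpTo; upTo; allFin; take; drop)
open import Data.List.Membership.Propositional using (_∈_)
open import Data.List.Membership.Propositional.Properties
  using (∈-map⁺; ∈-map⁻; ∈-filter⁺; ∈-filter⁻; ∈-upTo⁺; ∈-allFin; ∈-applyUpTo⁺; ∈-applyUpTo⁻;
    ∈-cartesianProductWith⁺; ∈-cartesianProductWith⁻; ∈-cartesianProduct⁺;
    ∈-cartesianProduct⁻)
open import Data.List.Membership.Propositional.Properties.WithK using (unique∧set⇒bag)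
open import Data.List.Properties
  using (map-∘; map-++; map-cong-local; map-injective; map-applyUpTo; map-upTo; ∷-injective;
    ∷-injectiveˡ; ∷-injectiveʳ; length-map; length-++; length-take; length-drop;
    length-tabulate; take++drop≡id; filter-accept; filter-reject)
open import Data.List.Relation.Binary.BagAndSetEquality using (∼bag⇒↭)
open import Data.List.Relation.Binary.Permutation.Propositional.Properties as ↭ using ()
open import Data.List.Relation.Unary.All as All using (All; []; _∷_)
open import Data.List.Relation.Unary.AllPairs using ([]; _∷_)
open import Data.List.Relation.Unary.Any using (here; there)
open import Data.List.Relation.Unary.Linked as Linked using (Linked; []; [-]; _∷_)
open import Data.List.Relation.Unary.Unique.Propositional using (Unique)
open import Data.List.Relation.Unary.Linked.Properties using (Linked⇒All)
import Data.List.Relation.Unary.Unique.Propositional.Properties as Unique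
open import Data.Nat using (ℕ; zero; suc; _+_; _*_; _∸_; _≤_; _<_; _≥_; _≤?_; _≟_; _!; z≤n; s≤s)
open import Data.Nat.Combinatorics using (_C_; k>n⇒nCk≡0; nCk+nC[k+1]≡[n+1]C[k+1])
open import Data.Nat.ListAction using (sum; product)
open import Data.Nat.ListAction.Properties using (sum-++; sum-↭)
open import Data.Nat.Properties
open import Algebra.Properties.CommutativeSemigroup +-commutativeSemigroup
  using (interchange; x∙yz≈y∙xz)
open import Data.Product using (Σ; ∃; _×_; _,_; proj₁; proj₂)
open import Data.Vec as Vec using (Vec; []; _∷_)
import Data.Vec.Properties as Vec
open import Function using (_∘_; mk⇔; Equivalence)
open import Relation.Binary.PropositionalEquality
  using (_≡_; _≢_; refl; sym; trans; cong; cong₂; module ≡-Reasoning)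
open import Relation.Nullary using (yes; no; contradiction)
open import Relation.Nullary.Decidable using (_×-dec_; ¬?)

open ≡-Reasoning

private
  variable
    A B D : Set

-- Finite sums over lists

∑-cong : ∀ {xs : List A} {f g : A → ℕ} → (∀ {x} → x ∈ xs → f x ≡ g x) →
  ∑-syntax xs f ≡ ∑-syntax xs g
∑-cong f≡g = cong sum (map-cong-local (All.tabulate f≡g))

∑-+ : ∀ (xs : List A) (f g : A → ℕ) →
  ∑[ x ∈ xs ] (f x + g x) ≡ ∑-syntax xs f + ∑-syntax xs g
∑-+ []       f g = refl
∑-+ (x ∷ xs) f g = trans (cong (f x + g x +_) (∑-+ xs f g))
  (interchange (f x) (g x) (∑-syntax xs f) (∑-syntax xs g))

*-distribˡ-∑ : ∀ c (xs : List A) (f : A → ℕ) → c * ∑-syntax xs f ≡ ∑[ x ∈ xs ] c * f x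
*-distribˡ-∑ c []       f = *-zeroʳ c
*-distribˡ-∑ c (x ∷ xs) f =
  trans (*-distribˡ-+ c (f x) (∑-syntax xs f)) (cong (c * f x +_) (*-distribˡ-∑ c xs f))

∑-const : ∀ (xs : List A) c → ∑[ _ ∈ xs ] c ≡ length xs * c
∑-const []       c = refl
∑-const (x ∷ xs) c = cong (c +_) (∑-const xs c)

∑-zero : ∀ (xs : List A) → ∑[ _ ∈ xs ] 0 ≡ 0
∑-zero xs = trans (∑-const xs 0) (*-zeroʳ (length xs))

∑-swap : ∀ (xs : List A) (ys : List B) (f : A → B → ℕ) →
  ∑[ x ∈ xs ] ∑[ y ∈ ys ] f x y ≡ ∑[ y ∈ ys ] ∑[ x ∈ xs ] f x y
∑-swap []       ys f = sym (∑-zero ys)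
∑-swap (x ∷ xs) ys f = trans (cong (∑-syntax ys (f x) +_) (∑-swap xs ys f))
  (sym (∑-+ ys (f x) (λ y → ∑[ z ∈ xs ] f z y)))

∑-map : ∀ (h : B → ℕ) (f : A → B) xs → ∑-syntax (map f xs) h ≡ ∑-syntax xs (h ∘ f)
∑-map h f xs = cong sum (sym (map-∘ xs))

∑-cartesianProductWith : ∀ (h : D → ℕ) (f : A → B → D) xs ys →
  ∑-syntax (cartesianProductWith f xs ys) h ≡ ∑[ x ∈ xs ] ∑[ y ∈ ys ] h (f x y)
∑-cartesianProductWith h f []       ys = refl
∑-cartesianProductWith h f (x ∷ xs) ys = begin
  sum (map h (map (f x) ys ++ zs))           ≡⟨ cong sum (map-++ h (map (f x) ys) zs) ⟩
  sum (map h (map (f x) ys) ++ map h zs)     ≡⟨ sum-++ (map h (map (f x) ys)) (map h zs) ⟩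
  ∑-syntax (map (f x) ys) h + ∑-syntax zs h
    ≡⟨ cong₂ _+_ (∑-map h (f x) ys) (∑-cartesianProductWith h f xs ys) ⟩
  ∑[ z ∈ x ∷ xs ] ∑[ y ∈ ys ] h (f z y)      ∎
  where zs = cartesianProductWith f xs ys

∑-applyUpTo : ∀ (f : ℕ → ℕ) (g : ℕ → ℕ) m → ∑-syntax (applyUpTo g m) f ≡ ∑[ i ∈ upTo m ] f (g i)
∑-applyUpTo f g m = cong sum (trans (map-applyUpTo g f m) (sym (map-upTo (f ∘ g) m)))

∑-filter-nonzero : ∀ (f : A → ℕ) xs → ∑-syntax (filter (λ x → ¬? (f x ≟ 0)) xs) f ≡ ∑-syntax xs f
∑-filter-nonzero f []       = refl
∑-filter-nonzero f (x ∷ xs) with f x in fx≡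
... | zero  = ∑-filter-nonzero f xs
... | suc _ = cong₂ _+_ fx≡ (∑-filter-nonzero f xs)

-- Once the zeros of `f` are discarded, two repetition-free lists with the same members are
-- permutations of each other. This is how the index set of a sum gets changed: arrangements to
-- pairs, and layer sequences to partitions.
∑-support : ∀ (f : A → ℕ) {xs ys} → Unique xs → Unique ys →
  (∀ {x} → f x ≢ 0 → x ∈ xs → x ∈ ys) → (∀ {x} → f x ≢ 0 → x ∈ ys → x ∈ xs) →
  ∑-syntax xs f ≡ ∑-syntax ys f
∑-support f {xs} {ys} xs! ys! to from = begin
  ∑-syntax xs f              ≡⟨ ∑-filter-nonzero f xs ⟨
  ∑-syntax (filter nz xs) f  ≡⟨ sum-↭ (↭.map⁺ f (∼bag⇒↭ (unique∧set⇒bag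
                                  (Unique.filter⁺ nz xs!) (Unique.filter⁺ nz ys!)
                                  (mk⇔ (restrict to) (restrict from))))) ⟩
  ∑-syntax (filter nz ys) f  ≡⟨ ∑-filter-nonzero f ys ⟩
  ∑-syntax ys f              ∎
  where
  nz = λ x → ¬? (f x ≟ 0)
  restrict : ∀ {us vs} → (∀ {x} → f x ≢ 0 → x ∈ us → x ∈ vs) →
    ∀ {x} → x ∈ filter nz us → x ∈ filter nz vs
  restrict sub x∈ = let x∈us , fx≢0 = ∈-filter⁻ nz x∈ in ∈-filter⁺ nz (sub fx≢0 x∈us) fx≢0

-- Permutations of the balls

-- `occurrences b t` unfolds to `count b (content t)`, so being an arrangement is a condition on the
-- word `content t` alone.
count : ∀ {q} → Fin q → List (Fin q) → ℕ
count b w = length (filter (b Fin.≟_) w)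

count-here : ∀ {q} (b : Fin q) w → count b (b ∷ w) ≡ suc (count b w)
count-here b w = cong length (filter-accept (b Fin.≟_) refl)

count-there : ∀ {q} {b c : Fin q} → b ≢ c → ∀ w → count b (c ∷ w) ≡ count b w
count-there b≢c w = cong length (filter-reject (_ Fin.≟_) b≢c)

count≡0⇒∉ : ∀ {q} (b : Fin q) w → count b w ≡ 0 → All (b ≢_) w
count≡0⇒∉ b []      _ = []
count≡0⇒∉ b (c ∷ w) eq with b Fin.≟ c
... | no b≢c = b≢c ∷ count≡0⇒∉ b w eq

count-punchIn : ∀ {q} (b : Fin (suc q)) c w → count (punchIn b c) (map (punchIn b) w) ≡ count c w
count-punchIn b c []      = refl
count-punchIn b c (d ∷ w) with c Fin.≟ d
... | yes refl = trans (count-here (punchIn b c) (map (punchIn b) w)) (cong suc (count-punchIn b c w))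
... | no  c≢d  = trans (count-there (c≢d ∘ punchIn-injective b c d) (map (punchIn b) w)) (count-punchIn b c w)

count-punchIn-self : ∀ {q} (b : Fin (suc q)) w → count b (map (punchIn b) w) ≡ 0
count-punchIn-self b []      = refl
count-punchIn-self b (d ∷ w) =
  trans (count-there (punchInᵢ≢i b d ∘ sym) (map (punchIn b) w)) (count-punchIn-self b w)

-- The image of `punchIn b` is every letter except `b`, so `punchOut` standardises such a word
-- letter by letter.
∉⇒punchIn : ∀ {q} {b : Fin (suc q)} {w} → All (b ≢_) w → ∃ λ w′ → w ≡ map (punchIn b) w′
∉⇒punchIn []            = [] , refl
∉⇒punchIn (b≢c ∷ b∉w) with ∉⇒punchIn b∉w
... | w′ , refl = punchOut b≢c ∷ w′ , cong (_∷ _) (sym (punchIn-punchOut b≢c))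

-- A permutation is determined by its first letter b and by the standardisation of the rest.
extend : ∀ {q} → Fin (suc q) → List (Fin q) → List (Fin (suc q))
extend b w = b ∷ map (punchIn b) w

extend-injective : ∀ {q} {b c : Fin (suc q)} {v w} → extend b v ≡ extend c w → b ≡ c × v ≡ w
extend-injective {b = b} eq with ∷-injectiveˡ eq
... | refl = refl , map-injective (punchIn-injective b _ _) (∷-injectiveʳ eq)

permutations : ∀ q → List (List (Fin q))
permutations zero    = [] ∷ []
permutations (suc q) = cartesianProductWith extend (allFin (suc q)) (permutations q)

permutations-unique : ∀ q → Unique (permutations q)
permutations-unique zero    = [] ∷ []
permutations-unique (suc q) =
  Unique.cartesianProductWith⁺ extend extend-injective (Unique.allFin⁺ (suc q)) (permutations-unique q)

length-cartesianProductWith : ∀ (f : A → B → D) xs ys →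
  length (cartesianProductWith f xs ys) ≡ length xs * length ys
length-cartesianProductWith f []       ys = refl
length-cartesianProductWith f (x ∷ xs) ys = trans (length-++ (map (f x) ys))
  (cong₂ _+_ (length-map (f x) ys) (length-cartesianProductWith f xs ys))

length-permutations : ∀ q → length (permutations q) ≡ q !
length-permutations zero    = refl
length-permutations (suc q) = trans
  (length-cartesianProductWith extend (allFin (suc q)) (permutations q))
  (cong₂ _*_ (length-tabulate {n = suc q} (λ i → i)) (length-permutations q))

∈-permutations⁺ : ∀ q {w} → (∀ b → count b w ≡ 1) → w ∈ permutations q
∈-permutations⁺ zero    {[]}    _  = here refl
∈-permutations⁺ (suc q) {[]}    w! = contradiction (w! zero) λ ()
∈-permutations⁺ (suc q) {b ∷ w} w!
  -- The first letter uses up the only occurrence of `b`, so the rest avoids `b`.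
  with ∉⇒punchIn (count≡0⇒∉ b w (suc-injective (trans (sym (count-here b w)) (w! b))))
... | w′ , refl = ∈-cartesianProductWith⁺ extend (∈-allFin b) (∈-permutations⁺ q λ c → begin
  count c w′                                  ≡⟨ count-punchIn b c w′ ⟨
  count (punchIn b c) (map (punchIn b) w′)    ≡⟨ count-there (punchInᵢ≢i b c) (map (punchIn b) w′) ⟨
  count (punchIn b c) (extend b w′)           ≡⟨ w! (punchIn b c) ⟩
  1                                           ∎)

∈-permutations⇒count : ∀ q {w} → w ∈ permutations q → ∀ b → count b w ≡ 1
∈-permutations⇒count (suc q) w∈ b
  with ∈-cartesianProductWith⁻ extend (allFin (suc q)) (permutations q) w∈
-- A letter other than `c` is `punchIn c` of its `punchOut`, which reduces its count to the shorter
-- permutation.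
... | c , w′ , _ , w′∈ , refl with c Fin.≟ b
... | yes refl = trans (count-here b (map (punchIn b) w′)) (cong suc (count-punchIn-self b w′))
... | no  c≢b  = begin
  count b (extend c w′)             ≡⟨ count-there (c≢b ∘ sym) (map (punchIn c) w′) ⟩
  count b (map (punchIn c) w′)      ≡⟨ cong (λ d → count d (map (punchIn c) w′)) (punchIn-punchOut c≢b) ⟨
  count (punchIn c (punchOut c≢b)) (map (punchIn c) w′) ≡⟨ count-punchIn c (punchOut c≢b) w′ ⟩
  count (punchOut c≢b) w′           ≡⟨ ∈-permutations⇒count q w′∈ (punchOut c≢b) ⟩
  1                                 ∎

∈-permutations⇒length : ∀ q {w} → w ∈ permutations q → length w ≡ q
∈-permutations⇒length zero    (here refl) = refl
∈-permutations⇒length (suc q) w∈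
  with ∈-cartesianProductWith⁻ extend (allFin (suc q)) (permutations q) w∈
... | c , w′ , _ , w′∈ , refl = cong suc (trans (length-map (punchIn c) w′) (∈-permutations⇒length q w′∈))

-- Arrangements as pairs of a shape and a permutation

shape : ∀ {n} → Vec (List A) n → Vec ℕ n
shape = Vec.map length

content : ∀ {n} → Vec (List A) n → List A
content t = concat (Vec.toList t)

++-injective : ∀ (u v : List A) {x y} → length u ≡ length v → u ++ x ≡ v ++ y → u ≡ v × x ≡ y
++-injective []      []      _   eq = refl , eq
++-injective (a ∷ u) (b ∷ v) len eq with ∷-injective eq
... | refl , eq′ with ++-injective u v (suc-injective len) eq′
... | refl , x≡y = refl , x≡y

-- The sizes say where the content is to be cut, so nothing is lost by concatenating the tubes.
shape-content-injective : ∀ {n} (t u : Vec (List A) n) →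
  shape t ≡ shape u → content t ≡ content u → t ≡ u
shape-content-injective []      []      _  _  = refl
shape-content-injective (x ∷ t) (y ∷ u) sh co with Vec.∷-injective sh
... | len , sh′ with ++-injective x y len co
... | refl , co′ = cong (x ∷_) (shape-content-injective t u sh′ co′)

-- Surjectivity of the encoding: the word is cut into consecutive blocks of the prescribed sizes.
fill : ∀ {n} (r : Vec ℕ n) (w : List A) → length w ≡ Vec.sum r →
  ∃ λ (t : Vec (List A) n) → shape t ≡ r × content t ≡ w
fill []      []  _   = [] , refl , refl
fill (k ∷ r) w   len with fill r (drop k w)
  (trans (length-drop k w) (trans (cong (_∸ k) len) (m+n∸m≡n k (Vec.sum r))))
... | t , refl , co = take k w ∷ t
  , cong (_∷ shape t) (trans (length-take k w) (m≤n⇒m⊓n≡m (≤-trans (m≤m+n k _) (≤-reflexive (sym len)))))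
  , trans (cong (take k w ++_) co) (take++drop≡id k w)

sum-shape : ∀ {n} (t : Vec (List A) n) → Vec.sum (shape t) ≡ length (content t)
sum-shape []      = refl
sum-shape (x ∷ t) = trans (cong (length x +_) (sum-shape t)) (sym (length-++ x))

lookup≤sum : ∀ {n} (r : Vec ℕ n) i → Vec.lookup r i ≤ Vec.sum r
lookup≤sum (k ∷ r) zero    = m≤m+n k (Vec.sum r)
lookup≤sum (k ∷ r) (suc i) = ≤-trans (lookup≤sum r i) (m≤n+m (Vec.sum r) k)

-- The weight `φ` is kept general because removing a layer replaces it by `φ ∘ suc`; collisions are
-- the case `_C s`.
coll : (ℕ → ℕ) → ∀ {n} → Vec ℕ n → ℕ
coll φ r = Vec.sum (Vec.map φ r)

-- The indicator of `a ≡ q` times `b`. Writing the condition on the total as a weight lets sums run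
-- over all vectors or lists of bounded entries.
restrictTo : ℕ → ℕ → ℕ → ℕ
restrictTo q a b with a ≟ q
... | yes _ = b
... | no  _ = 0

restrictTo-≡ : ∀ {q a} b → a ≡ q → restrictTo q a b ≡ b
restrictTo-≡ {q} {a} b a≡q with a ≟ q
... | yes _  = refl
... | no a≢q = contradiction a≡q a≢q

restrictTo-≢0 : ∀ {q a b} → restrictTo q a b ≢ 0 → a ≡ q × b ≢ 0
restrictTo-≢0 {q} {a} nz with a ≟ q
... | yes a≡q = a≡q , nz
... | no  _   = contradiction refl nz

C-T-shapes : ∀ n q s → C-T n q s ≡
  q ! * (∑[ r ∈ vectors (upTo (suc q)) n ] restrictTo q (Vec.sum r) (coll (_C s) r))
C-T-shapes n q s = begin
  ∑[ t ∈ arrangements n q ] collisions s t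
    ≡⟨ ∑-cong {xs = arrangements n q} (λ {t} t∈ → trans
         (cong Vec.sum (Vec.map-∘ (_C s) length t))
         (sym (restrictTo-≡ _ (trans (sum-shape t) (∈-permutations⇒length q (content∈ t∈)))))) ⟩
  ∑[ t ∈ arrangements n q ] weight (encode t)
    ≡⟨ ∑-map weight encode (arrangements n q) ⟨
  ∑-syntax (map encode (arrangements n q)) weight
    -- Pairs whose shape does not add up to `q` weigh 0; every other pair of nonzero weight encodes
    -- an arrangement.
    ≡⟨ ∑-support weight
         (Unique.map⁺ (λ {t} {u} eq → shape-content-injective t u (cong proj₁ eq) (cong proj₂ eq))
           (arrangements-unique n q))
         (Unique.cartesianProduct⁺ (vectors-unique (Unique.upTo⁺ (suc q)) n) (permutations-unique q))
         to from ⟩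
  ∑-syntax (cartesianProduct shapes (permutations q)) weight
    ≡⟨ ∑-cartesianProductWith weight _,_ shapes (permutations q) ⟩
  ∑[ r ∈ shapes ] ∑[ w ∈ permutations q ] f r
    ≡⟨ ∑-cong {xs = shapes} (λ {r} _ →
         trans (∑-const (permutations q) (f r)) (cong (_* f r) (length-permutations q))) ⟩
  ∑[ r ∈ shapes ] q ! * f r
    ≡⟨ *-distribˡ-∑ (q !) shapes f ⟨
  q ! * ∑-syntax shapes f ∎
  where
  shapes : List (Vec ℕ n)
  shapes = vectors (upTo (suc q)) n

  f : Vec ℕ n → ℕ
  f r = restrictTo q (Vec.sum r) (coll (_C s) r)

  encode : Placement n q → Vec ℕ n × List (Fin q)
  encode t = shape t , content t

  weight : Vec ℕ n × List (Fin q) → ℕ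
  weight (r , _) = f r

  content∈ : ∀ {t} → t ∈ arrangements n q → content t ∈ permutations q
  content∈ t∈ = ∈-permutations⁺ q (Equivalence.to (∈-arrangements n q) t∈)

  to : ∀ {p} → weight p ≢ 0 → p ∈ map encode (arrangements n q) → p ∈ cartesianProduct shapes (permutations q)
  to nz p∈ with ∈-map⁻ encode p∈
  ... | t , t∈ , refl = ∈-cartesianProduct⁺
    (∈-vectors (shape t) (λ i → ∈-upTo⁺ (s≤s (≤-trans (lookup≤sum (shape t) i)
      (≤-reflexive (proj₁ (restrictTo-≢0 nz)))))))
    (content∈ t∈)

  from : ∀ {p} → weight p ≢ 0 → p ∈ cartesianProduct shapes (permutations q) → p ∈ map encode (arrangements n q)
  from {r , w} nz p∈ with ∈-cartesianProduct⁻ shapes (permutations q) p∈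
  -- A nonzero weight forces the sizes in `r` to add up to `q`, the length of `w`.
  ... | _ , w∈ with fill r w (trans (∈-permutations⇒length q w∈) (sym (proj₁ (restrictTo-≢0 nz))))
  ... | t , refl , refl = ∈-map⁺ encode (Equivalence.from (∈-arrangements n q) (∈-permutations⇒count q w∈))

-- Layers: the balls at height 1, then at height 2, and so on

∑-upTo-suc : ∀ (f : ℕ → ℕ) m → ∑-syntax (upTo (suc m)) f ≡ f 0 + ∑[ i ∈ upTo m ] f (suc i)
∑-upTo-suc f m = cong (f 0 +_) (∑-applyUpTo f suc m)

push : ℕ → Σ ℕ (Vec ℕ) → Σ ℕ (Vec ℕ)
push k (m , r) = suc m , k ∷ r

-- Removal of the bottom layer. The number of nonempty tubes, which is the size of that layer,
-- varies with the vector and is therefore packed with the remaining sizes. `push k` records a tube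
-- with `k` balls above the bottom one.
peel : ∀ {n} → Vec ℕ n → Σ ℕ (Vec ℕ)
peel []          = 0 , []
peel (zero  ∷ r) = peel r
peel (suc k ∷ r) = push k (peel r)

-- Induction on n is Pascal's rule: the first tube is empty or one of the m nonempty ones.
∑-peel : ∀ N {n M} → n < M → (H : Σ ℕ (Vec ℕ) → ℕ) →
  ∑[ r ∈ vectors (upTo (suc N)) n ] H (peel r) ≡
  ∑[ m ∈ upTo M ] (n C m) * (∑[ r ∈ vectors (upTo N) m ] H (m , r))
∑-peel N {zero} {suc M} _ H = begin
  H (0 , []) + 0              ≡⟨ *-identityˡ _ ⟨
  1 * X 0                     ≡⟨ +-identityʳ _ ⟨
  1 * X 0 + 0                 ≡⟨ cong (1 * X 0 +_) (trans
                                   (∑-cong {xs = upTo M} (λ {m} _ → cong (_* X (suc m)) (k>n⇒nCk≡0 {0} {suc m} (s≤s z≤n))))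
                                   (∑-zero (upTo M))) ⟨
  1 * X 0 + ∑[ m ∈ upTo M ] (0 C suc m) * X (suc m) ≡⟨ ∑-upTo-suc (λ m → (0 C m) * X m) M ⟨
  ∑[ m ∈ upTo (suc M) ] (0 C m) * X m ∎
  where
  X : ℕ → ℕ
  X m = ∑[ r ∈ vectors (upTo N) m ] H (m , r)
∑-peel N {suc n} {suc M} (s≤s n<M) H = begin
  ∑[ r ∈ vectors (upTo (suc N)) (suc n) ] H (peel r)
    ≡⟨ ∑-cartesianProductWith (H ∘ peel) _∷_ (upTo (suc N)) (vectors (upTo (suc N)) n) ⟩
  ∑[ k ∈ upTo (suc N) ] ∑[ r ∈ vectors (upTo (suc N)) n ] H (peel (k ∷ r))
    ≡⟨ ∑-upTo-suc (λ k → ∑[ r ∈ vectors (upTo (suc N)) n ] H (peel (k ∷ r))) N ⟩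
  ∑[ r ∈ vectors (upTo (suc N)) n ] H (peel r)
    + (∑[ k ∈ upTo N ] ∑[ r ∈ vectors (upTo (suc N)) n ] H (push k (peel r)))
    -- The summands are the cases of an empty and a nonempty first tube. The first uses the bound
    -- `suc M`, so that its term for 0 can be split off and the rest aligned with the second.
    ≡⟨ cong₂ _+_ (∑-peel N (m<n⇒m<1+n n<M) H) nonempty ⟩
  ∑[ m ∈ upTo (suc M) ] (n C m) * X m + (∑[ m ∈ upTo M ] (n C m) * X (suc m))
    ≡⟨ cong (_+ (∑[ m ∈ upTo M ] (n C m) * X (suc m))) (∑-upTo-suc (λ m → (n C m) * X m) M) ⟩
  1 * X 0 + (∑[ m ∈ upTo M ] (n C suc m) * X (suc m)) + (∑[ m ∈ upTo M ] (n C m) * X (suc m))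
    ≡⟨ +-assoc (1 * X 0) _ _ ⟩
  1 * X 0 + ((∑[ m ∈ upTo M ] (n C suc m) * X (suc m)) + (∑[ m ∈ upTo M ] (n C m) * X (suc m)))
    ≡⟨ cong (1 * X 0 +_) (∑-+ (upTo M) (λ m → (n C suc m) * X (suc m)) (λ m → (n C m) * X (suc m))) ⟨
  1 * X 0 + (∑[ m ∈ upTo M ] ((n C suc m) * X (suc m) + (n C m) * X (suc m)))
    ≡⟨ cong (1 * X 0 +_) (∑-cong {xs = upTo M} (λ {m} _ → pascal m)) ⟩
  1 * X 0 + (∑[ m ∈ upTo M ] (suc n C suc m) * X (suc m))
    ≡⟨ ∑-upTo-suc (λ m → (suc n C m) * X m) M ⟨
  ∑[ m ∈ upTo (suc M) ] (suc n C m) * X m ∎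
  where
  X : ℕ → ℕ
  X m = ∑[ r ∈ vectors (upTo N) m ] H (m , r)

  pascal : ∀ m → (n C suc m) * X (suc m) + (n C m) * X (suc m) ≡ (suc n C suc m) * X (suc m)
  pascal m = trans (sym (*-distribʳ-+ (X (suc m)) (n C suc m) (n C m)))
    (cong (_* X (suc m)) (trans (+-comm (n C suc m) (n C m)) (nCk+nC[k+1]≡[n+1]C[k+1] n m)))

  nonempty : ∑[ k ∈ upTo N ] ∑[ r ∈ vectors (upTo (suc N)) n ] H (push k (peel r))
    ≡ ∑[ m ∈ upTo M ] (n C m) * X (suc m)
  nonempty = begin
    ∑[ k ∈ upTo N ] ∑[ r ∈ vectors (upTo (suc N)) n ] H (push k (peel r))
      -- The nonempty first tube is absorbed into the function summed, which shifts the number of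
      -- nonempty tubes by one.
      ≡⟨ ∑-cong {xs = upTo N} (λ {k} _ → ∑-peel N n<M (H ∘ push k)) ⟩
    ∑[ k ∈ upTo N ] ∑[ m ∈ upTo M ] (n C m) * (∑[ r ∈ vectors (upTo N) m ] H (suc m , k ∷ r))
      ≡⟨ ∑-swap (upTo N) (upTo M) _ ⟩
    ∑[ m ∈ upTo M ] ∑[ k ∈ upTo N ] (n C m) * (∑[ r ∈ vectors (upTo N) m ] H (suc m , k ∷ r))
      ≡⟨ ∑-cong {xs = upTo M} (λ {m} _ → trans (sym (*-distribˡ-∑ (n C m) (upTo N) _))
           (cong ((n C m) *_) (sym (∑-cartesianProductWith (λ r → H (suc m , r)) _∷_ (upTo N) (vectors (upTo N) m))))) ⟩
    ∑[ m ∈ upTo M ] (n C m) * X (suc m) ∎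

peel-length : ∀ {n} (r : Vec ℕ n) → proj₁ (peel r) ≤ n
peel-length []          = z≤n
peel-length (zero  ∷ r) = m≤n⇒m≤1+n (peel-length r)
peel-length (suc k ∷ r) = s≤s (peel-length r)

sum-peel : ∀ {n} (r : Vec ℕ n) → Vec.sum r ≡ proj₁ (peel r) + Vec.sum (proj₂ (peel r))
sum-peel []          = refl
sum-peel (zero  ∷ r) = sum-peel r
sum-peel (suc k ∷ r) = cong suc (begin
  k + Vec.sum r   ≡⟨ cong (k +_) (sum-peel r) ⟩
  k + (m + σ)     ≡⟨ x∙yz≈y∙xz k m σ ⟩
  m + (k + σ)     ∎)
  where
  m = proj₁ (peel r)
  σ = Vec.sum (proj₂ (peel r))

-- Each empty tube contributes `φ 0`; every other tube has one ball more than after peeling, hence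
-- `φ ∘ suc`.
coll-peel : ∀ φ {n} (r : Vec ℕ n) →
  coll φ r ≡ (n ∸ proj₁ (peel r)) * φ 0 + coll (φ ∘ suc) (proj₂ (peel r))
coll-peel φ []                  = refl
coll-peel φ {suc n} (zero ∷ r)  = begin
  φ 0 + coll φ r                        ≡⟨ cong (φ 0 +_) (coll-peel φ r) ⟩
  φ 0 + ((n ∸ m) * φ 0 + κ)             ≡⟨ +-assoc (φ 0) _ κ ⟨
  suc (n ∸ m) * φ 0 + κ                 ≡⟨ cong (λ d → d * φ 0 + κ) (+-∸-assoc 1 (peel-length r)) ⟨
  (suc n ∸ m) * φ 0 + κ                 ∎
  where
  m = proj₁ (peel r)
  κ = coll (φ ∘ suc) (proj₂ (peel r))
coll-peel φ {suc n} (suc k ∷ r) =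
  trans (cong (φ (suc k) +_) (coll-peel φ r)) (x∙yz≈y∙xz (φ (suc k)) ((n ∸ proj₁ (peel r)) * φ 0) _)

-- The number of shapes of n tubes whose i-th layer has μᵢ balls.
mult : ℕ → List ℕ → ℕ
mult n []      = 1
mult n (m ∷ μ) = (n C m) * mult m μ

-- The sum of φ over the tube sizes, for any shape of n tubes with layers μ.
layerSum : (ℕ → ℕ) → ℕ → List ℕ → ℕ
layerSum φ n []      = n * φ 0
layerSum φ n (m ∷ μ) = (n ∸ m) * φ 0 + layerSum (φ ∘ suc) m μ

-- Induction on the bound `N` for the tube sizes, one layer at a time. `G` is arbitrary so that it
-- can absorb the layers already removed, and `M` stays fixed so that all layers share one range;
-- choices with a layer larger than the previous one are killed by `mult`.
∑-shapes : ∀ N {n M} → n ≤ M → ∀ φ (G : ℕ → ℕ → ℕ) →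
  ∑[ r ∈ vectors (upTo (suc N)) n ] G (Vec.sum r) (coll φ r) ≡
  ∑[ μ ∈ lists≤ (applyUpTo suc M) N ] mult n μ * G (sum μ) (layerSum φ n μ)
∑-shapes zero {zero} _ φ G = cong (_+ 0) (sym (*-identityˡ (G 0 0)))
∑-shapes zero {suc n} n<M φ G = begin
  ∑[ r ∈ vectors (0 ∷ []) (suc n) ] G (Vec.sum r) (coll φ r)
    ≡⟨ ∑-cartesianProductWith _ _∷_ (0 ∷ []) (vectors (0 ∷ []) n) ⟩
  ∑[ r ∈ vectors (0 ∷ []) n ] G (Vec.sum r) (φ 0 + coll φ r) + 0
    ≡⟨ +-identityʳ _ ⟩
  ∑[ r ∈ vectors (0 ∷ []) n ] G (Vec.sum r) (φ 0 + coll φ r)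
    ≡⟨ ∑-shapes zero (<⇒≤ n<M) φ (λ a b → G a (φ 0 + b)) ⟩
  1 * G 0 (φ 0 + n * φ 0) + 0 ∎
∑-shapes (suc N) {n} {M} n≤M φ G = begin
  ∑[ r ∈ vectors (upTo (suc (suc N))) n ] G (Vec.sum r) (coll φ r)
    ≡⟨ ∑-cong {xs = vectors (upTo (suc (suc N))) n} (λ {r} _ → cong₂ G (sum-peel r) (coll-peel φ r)) ⟩
  ∑[ r ∈ vectors (upTo (suc (suc N))) n ] H (peel r)
    ≡⟨ ∑-peel (suc N) (s≤s n≤M) H ⟩
  ∑[ m ∈ upTo (suc M) ] (n C m) * (∑[ r ∈ vectors (upTo (suc N)) m ] H (m , r))
    -- With no nonempty tube the layer sequence is `[]`; otherwise it starts with some `m` from 1 to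
    -- `M`.
    ≡⟨ cong₂ _+_ (cong (1 *_) (trans (+-identityʳ _) (cong (G 0) (+-identityʳ (n * φ 0)))))
         (∑-cong {xs = applyUpTo suc M} λ {m} m∈ → layer m m∈) ⟩
  1 * G 0 (n * φ 0)
    + (∑[ m ∈ applyUpTo suc M ] ∑[ μ ∈ lists≤ (applyUpTo suc M) N ] term (m ∷ μ))
    ≡⟨ cong (1 * G 0 (n * φ 0) +_)
         (∑-cartesianProductWith term _∷_ (applyUpTo suc M) (lists≤ (applyUpTo suc M) N)) ⟨
  ∑[ μ ∈ lists≤ (applyUpTo suc M) (suc N) ] term μ ∎
  where
  H : Σ ℕ (Vec ℕ) → ℕ
  H (m , r) = G (m + Vec.sum r) ((n ∸ m) * φ 0 + coll (φ ∘ suc) r)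

  term : List ℕ → ℕ
  term μ = mult n μ * G (sum μ) (layerSum φ n μ)

  layer : ∀ m → m ∈ applyUpTo suc M →
    (n C m) * (∑[ r ∈ vectors (upTo (suc N)) m ] H (m , r)) ≡
    ∑[ μ ∈ lists≤ (applyUpTo suc M) N ] term (m ∷ μ)
  layer m m∈ with ∈-applyUpTo⁻ suc m∈
  ... | _ , m≤M , refl = begin
    (n C m) * (∑[ r ∈ vectors (upTo (suc N)) m ] H (m , r))
      ≡⟨ cong ((n C m) *_) (∑-shapes N m≤M (φ ∘ suc) (λ a b → G (m + a) ((n ∸ m) * φ 0 + b))) ⟩
    (n C m) * (∑[ μ ∈ lists≤ (applyUpTo suc M) N ] mult m μ * G (sum (m ∷ μ)) (layerSum φ n (m ∷ μ)))
      ≡⟨ *-distribˡ-∑ (n C m) (lists≤ (applyUpTo suc M) N) _ ⟩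
    ∑[ μ ∈ lists≤ (applyUpTo suc M) N ] (n C m) * (mult m μ * G (sum (m ∷ μ)) (layerSum φ n (m ∷ μ)))
      ≡⟨ ∑-cong {xs = lists≤ (applyUpTo suc M) N} (λ {μ} _ → sym (*-assoc (n C m) (mult m μ) _)) ⟩
    ∑[ μ ∈ lists≤ (applyUpTo suc M) N ] term (m ∷ μ) ∎

-- Comparison with the sum over partitions

-- Used to move a lower limit from 1 down to 0 and up again to `s`. The bound `a ≤ suc b` makes the
-- truncated subtraction in `a ⋯ b` exact.
∑-⋯ : ∀ a b (f : ℕ → ℕ) → a ≤ suc b → (∀ i → i < a → f i ≡ 0) →
  ∑[ i ∈ a ⋯ b ] f i ≡ ∑[ i ∈ upTo (suc b) ] f i
∑-⋯ a b f a≤1+b f≡0 = begin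
  ∑[ i ∈ a ⋯ b ] f i                       ≡⟨ ∑-applyUpTo f (a +_) (suc b ∸ a) ⟩
  ∑[ i ∈ upTo (suc b ∸ a) ] f (a + i)      ≡⟨ drop-zeros a f f≡0 ⟨
  ∑[ i ∈ upTo (a + (suc b ∸ a)) ] f i      ≡⟨ cong (λ m → ∑-syntax (upTo m) f) (m+[n∸m]≡n a≤1+b) ⟩
  ∑[ i ∈ upTo (suc b) ] f i                ∎
  where
  drop-zeros : ∀ a {m} (f : ℕ → ℕ) → (∀ i → i < a → f i ≡ 0) →
    ∑[ i ∈ upTo (a + m) ] f i ≡ ∑[ i ∈ upTo m ] f (a + i)
  drop-zeros zero        f _  = refl
  drop-zeros (suc a) {m} f f0 = trans (∑-upTo-suc f (a + m))
    (cong₂ _+_ (f0 0 (s≤s z≤n)) (drop-zeros a (f ∘ suc) (λ i i<a → f0 (suc i) (s≤s i<a))))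

mult-∏ : ∀ x ν → mult x ν ≡
  ∏[ i ∈ 2 ⋯ length (x ∷ ν) ] (part (x ∷ ν) (i ∸ 1) C part (x ∷ ν) i)
mult-∏ x ν = trans (go x ν) (cong product (sym (map-applyUpTo (2 +_) _ (length ν))))
  where
  go : ∀ x ν → mult x ν ≡
    product (applyUpTo (λ i → part (x ∷ ν) (1 + i) C part (x ∷ ν) (2 + i)) (length ν))
  go x []      = refl
  go x (y ∷ ν) = cong ((x C y) *_) (go y ν)

-- Nothing lies above the last layer, so each of its tubes has size exactly the number of layers;
-- this gives the term outside the sum. The weight is `φ ∘ suc` because these tubes all reach the
-- first layer `x`.
layerSum-∑ : ∀ φ x ν → layerSum (φ ∘ suc) x ν ≡
  part (x ∷ ν) (length (x ∷ ν)) * φ (length (x ∷ ν))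
    + (∑[ i ∈ 1 ⋯ length ν ] ((part (x ∷ ν) i ∸ part (x ∷ ν) (i + 1)) * φ i))
layerSum-∑ φ x ν = trans (go φ x ν)
  (cong (λ xs → part (x ∷ ν) (length (x ∷ ν)) * φ (length (x ∷ ν)) + sum xs)
    (sym (map-applyUpTo (1 +_) _ (length ν))))
  where
  go : ∀ φ x ν → layerSum (φ ∘ suc) x ν ≡
    part (x ∷ ν) (length (x ∷ ν)) * φ (length (x ∷ ν))
      + sum (applyUpTo (λ i → (part (x ∷ ν) (1 + i) ∸ part (x ∷ ν) (1 + i + 1)) * φ (1 + i)) (length ν))
  go φ x []      = sym (+-identityʳ _)
  go φ x (y ∷ ν) = trans (cong ((x ∸ y) * φ 1 +_) (go (φ ∘ suc) y ν))
    (x∙yz≈y∙xz ((x ∸ y) * φ 1) (part (y ∷ ν) (length (y ∷ ν)) * φ (suc (length (y ∷ ν)))) _)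

-- No tube holds more balls than there are layers. For `_C s` this excludes sequences with fewer
-- than `s` layers.
layerSum-zero : ∀ φ n μ → (∀ i → i ≤ length μ → φ i ≡ 0) → layerSum φ n μ ≡ 0
layerSum-zero φ n []      φ≡0 = trans (cong (n *_) (φ≡0 0 z≤n)) (*-zeroʳ n)
layerSum-zero φ n (m ∷ μ) φ≡0 = cong₂ _+_
  (trans (cong ((n ∸ m) *_) (φ≡0 0 z≤n)) (*-zeroʳ (n ∸ m)))
  (layerSum-zero (φ ∘ suc) m μ (λ i i≤ → φ≡0 (suc i) (s≤s i≤)))

-- Every factor `n C m` must be nonzero, which forces `m ≤ n`. Keeping `n` in front of the list also
-- records the bound on the first part.
mult≢0⇒Linked : ∀ n μ → mult n μ ≢ 0 → Linked _≥_ (n ∷ μ)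
mult≢0⇒Linked n []      _  = [-]
mult≢0⇒Linked n (m ∷ μ) nz with m ≤? n
... | no  m≰n = contradiction (cong (_* mult m μ) (k>n⇒nCk≡0 (≰⇒> m≰n))) nz
... | yes m≤n = m≤n ∷ mult≢0⇒Linked m μ
  (λ eq → nz (trans (cong ((n C m) *_) eq) (*-zeroʳ (n C m))))

∈-lists≤⁻ : ∀ {xs ys : List A} m → ys ∈ lists≤ xs m → All (_∈ xs) ys × length ys ≤ m
∈-lists≤⁻ zero    (here refl) = [] , z≤n
∈-lists≤⁻ (suc m) (here refl) = [] , z≤n
∈-lists≤⁻ {xs = xs} (suc m) (there ys∈) with ∈-cartesianProductWith⁻ _∷_ xs (lists≤ xs m) ys∈
... | _ , _ , y∈ , zs∈ , refl = let all , len = ∈-lists≤⁻ m zs∈ in y∈ ∷ all , s≤s len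

module _ (n q s : ℕ) (0<s : 0 < s) where

  private
    layered : List ℕ → ℕ
    layered μ = mult n μ * restrictTo q (sum μ) (layerSum (_C s) n μ)

    partitionTerm : List ℕ → ℕ
    partitionTerm μ =
      (n C part μ 1)
        * (∏[ i ∈ 2 ⋯ length μ ] (part μ (i ∸ 1) C part μ i))
        * (part μ (length μ) * (length μ C s)
            + (∑[ i ∈ s ⋯ (length μ ∸ 1) ] ((part μ i ∸ part μ (i + 1)) * (i C s))))

    P? = λ μ → (part μ 1 ≤? n) ×-dec (s ≤? length μ)

    candidates : List (List ℕ)
    candidates = lists≤ (applyUpTo suc n) q

    -- Each condition has its own source: monotonicity and the bound on the first part come from
    -- `mult`, the total from `restrictTo`, at least `s` parts from the nonzero layer sum, and
    -- positivity from the candidate entries.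
    support⇒partition : ∀ {μ} → layered μ ≢ 0 → μ ∈ candidates → μ ∈ filter P? (partitions q)
    support⇒partition {μ} nz μ∈ = ∈-filter⁺ P?
      (Equivalence.from (∈-partitions q) (Linked.tail decreasing , positive , proj₁ restricted))
      (head≤ decreasing , ≮⇒≥ (λ k<s → proj₂ restricted
        (layerSum-zero (_C s) n μ (λ i i≤k → k>n⇒nCk≡0 (≤-<-trans i≤k k<s)))))
      where
      decreasing : Linked _≥_ (n ∷ μ)
      decreasing = mult≢0⇒Linked n μ (λ eq → nz (cong (_* restrictTo q (sum μ) (layerSum (_C s) n μ)) eq))

      restricted : sum μ ≡ q × layerSum (_C s) n μ ≢ 0
      restricted = restrictTo-≢0 (λ eq → nz (trans (cong (mult n μ *_) eq) (*-zeroʳ (mult n μ))))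

      positive : All (1 ≤_) μ
      positive = All.map (λ x∈ → ≤-trans (s≤s z≤n) (≤-reflexive (sym (proj₂ (proj₂ (∈-applyUpTo⁻ suc x∈))))))
        (proj₁ (∈-lists≤⁻ q μ∈))

      head≤ : ∀ {ν} → Linked _≥_ (n ∷ ν) → part ν 1 ≤ n
      head≤ [-]       = z≤n
      head≤ (x≤n ∷ _) = x≤n

    partition⇒candidate : ∀ {μ} → μ ∈ filter P? (partitions q) → μ ∈ candidates
    partition⇒candidate {μ} μ∈ with ∈-filter⁻ P? {xs = partitions q} μ∈
    ... | μ∈p , λ₁≤n , _ with ∈-filter⁻ (isPartition? q) {xs = lists≤ (upTo (suc q)) q} μ∈p
    ... | μ∈l , linked , positive , _ =
      -- The bound `q` on the length is read off the list that `partitions` filters.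
      ∈-lists≤ (All.zipWith entry (positive , bounded linked λ₁≤n)) (proj₂ (∈-lists≤⁻ q μ∈l))
      where
      bounded : ∀ {ν} → Linked _≥_ ν → part ν 1 ≤ n → All (_≤ n) ν
      bounded {[]}    _    _   = []
      bounded {x ∷ ν} link x≤n = Linked⇒All (λ i≥j j≥k → ≤-trans j≥k i≥j) x≤n link

      entry : ∀ {x} → 1 ≤ x × x ≤ n → x ∈ applyUpTo suc n
      entry {suc x} (_ , x<n) = ∈-applyUpTo⁺ suc x<n

    layered-formula : ∀ {μ} → μ ∈ filter P? (partitions q) → layered μ ≡ partitionTerm μ
    layered-formula {μ} μ∈ with ∈-filter⁻ P? {xs = partitions q} μ∈
    layered-formula {[]}    μ∈ | _   , _ , s≤k = contradiction s≤k (<⇒≱ 0<s)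
    layered-formula {x ∷ ν} μ∈ | μ∈p , _ , s≤k =
      cong₂ _*_ (cong ((n C x) *_) (mult-∏ x ν)) (begin
        restrictTo q (sum (x ∷ ν)) (layerSum (_C s) n (x ∷ ν))
          ≡⟨ restrictTo-≡ _ (proj₂ (proj₂ (Equivalence.to (∈-partitions q) μ∈p))) ⟩
        (n ∸ x) * (0 C s) + layerSum (λ i → suc i C s) x ν
          -- The `n ∸ x` empty tubes have no collisions, since `0 C s` is 0 for positive `s`.
          ≡⟨ cong (_+ layerSum (λ i → suc i C s) x ν)
               (trans (cong ((n ∸ x) *_) (k>n⇒nCk≡0 0<s)) (*-zeroʳ (n ∸ x))) ⟩
        layerSum (λ i → suc i C s) x ν
          ≡⟨ layerSum-∑ (_C s) x ν ⟩
        top + (∑[ i ∈ 1 ⋯ length ν ] jump i)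
          -- Sizes below `s` give no collisions, so both the sum from 1 and the sum from `s` equal
          -- the sum from 0.
          ≡⟨ cong (top +_) (∑-⋯ 1 (length ν) jump (s≤s z≤n) (λ i i<1 → jump≡0 i (<-≤-trans i<1 0<s))) ⟩
        top + (∑[ i ∈ upTo (suc (length ν)) ] jump i)
          ≡⟨ cong (top +_) (∑-⋯ s (length ν) jump s≤k jump≡0) ⟨
        top + (∑[ i ∈ s ⋯ length ν ] jump i) ∎)
      where
      top : ℕ
      top = part (x ∷ ν) (length (x ∷ ν)) * (length (x ∷ ν) C s)

      jump : ℕ → ℕ
      jump i = (part (x ∷ ν) i ∸ part (x ∷ ν) (i + 1)) * (i C s)

      jump≡0 : ∀ i → i < s → jump i ≡ 0
      jump≡0 i i<s = trans (cong ((part (x ∷ ν) i ∸ part (x ∷ ν) (i + 1)) *_) (k>n⇒nCk≡0 i<s))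
        (*-zeroʳ (part (x ∷ ν) i ∸ part (x ∷ ν) (i + 1)))

  ∑-layers≡∑-partitions :
    ∑[ μ ∈ candidates ] mult n μ * restrictTo q (sum μ) (layerSum (_C s) n μ) ≡
    ∑[ μ ∈ filter P? (partitions q) ] partitionTerm μ
  ∑-layers≡∑-partitions = trans
    (∑-support layered
      (lists≤-unique (Unique.applyUpTo⁺₁ suc n (λ i<j _ → <⇒≢ (s≤s i<j))) q)
      (Unique.filter⁺ P? (partitions-unique q))
      support⇒partition (λ _ → partition⇒candidate))
    (∑-cong {xs = filter P? (partitions q)} layered-formula)

theorem5p4 : ∀ (n q s : ℕ) → 1 ≤ n → 1 ≤ q → 2 ≤ s →
    C-T n q s ≡
    q ! * (∑[ μ ∈ filter (λ μ → (part μ 1 ≤? n) ×-dec (s ≤? length μ)) (partitions q) ]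
    ((n C part μ 1)
    * (∏[ i ∈ 2 ⋯ length μ ] (part μ (i ∸ 1) C part μ i))
    * (part μ (length μ) * (length μ C s)
    + (∑[ i ∈ s ⋯ (length μ ∸ 1) ] ((part μ i ∸ part μ (i + 1)) * (i C s))))))
theorem5p4 n q s _ _ 2≤s = trans (C-T-shapes n q s) (cong (q ! *_)
  -- Here `q` bounds both the tube sizes and the number of layers, and `≤-refl` sets the common
  -- bound on layers to `n`.
  (trans (∑-shapes q ≤-refl (_C s) (restrictTo q)) (∑-layers≡∑-partitions n q s (<⇒≤ 2≤s))))
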